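{- Let $\mathbb{N}=\{0,1,2,\dots\}$ and let $P(x_1,\dots,x_n)$ be a homogeneous polynomial with integer coefficients. Let $R_P=\{A\subseteq\mathbb{N}\mid\exists a_1,\dots,a_n\in A\text{ such that }P(a_1,\dots,a_n)=0\}$. The following are equivalent: (i) $R_P$ is partition regular; (ii) for every $\mathcal{U}\in\overline{K(\beta\mathbb{N},\odot)}$ we have $\mathcal{U}\subseteq R_P$. Moreover, if $R_P$ is partition regular then $I_P=\{\mathcal{U}\in\beta\mathbb{N}\mid\forall A\in\mathcal{U}\ A\in R_P\}$ is a closed bilateral (two-sided) ideal in $(\beta\mathbb{N},\odot)$.
   Context: A family of subsets of $\mathbb{N}$ is partition regular if for every finite partition $\mathbb{N}=A_1\cup\dots\cup A_m$ there is $i\leq m$ such that $A_i$ belongs to the family. The operation on $\beta\mathbb{N}$ is $\mathcal{U}\odot\mathcal{V}=\{A\subseteq\mathbb{N}\mid\{s\in\mathbb{N}\mid\{r\in\mathbb{N}\mid s\cdot r\in A\}\in\mathcal{V}\}\in\mathcal{U}\}$, $K(\beta\mathbb{N},\odot)$ is the minimal bilateral ideal of $(\beta\mathbb{N},\odot)$, and the bar denotes closure in the Stone topology. -}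

module Defs where

open import Level using (Level; 0ℓ; suc; _⊔_)
open import Data.Nat.Base using (ℕ; _*_)
open import Data.Integer.Base as ℤ using (ℤ; +_; 0ℤ; 1ℤ)
open import Data.Fin.Base using (Fin)
open import Data.List.Base as List using (List)
open import Data.List.Relation.Unary.All as ListAll using ()
open import Data.List.Relation.Unary.Unique.Propositional using (Unique)
open import Data.Product.Base using (_×_; _,_; ∃-syntax; Σ-syntax; proj₁; proj₂)
open import Data.Sum.Base using (_⊎_)
open import Data.Vec.Base as Vec using (Vec)
open import Data.Vec.Relation.Unary.All as VecAll using ()
open import Relation.Binary.PropositionalEquality.Core using (_≡_; _≢_)
open import Relation.Unary
  using (Pred; _∈_; _⊆_; _≐_; _∪_; _∩_; U; Satisfiable; _≬_)

private
  variable
    ℓ : Level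
    n : ℕ

Subset : Set₁
Subset = Pred ℕ 0ℓ

Family : Set₁
Family = Pred Subset 0ℓ

------------------------------------------------------------------------
-- Partition regularity

record IsPartition {m : ℕ} (A : Fin m → Subset) : Set where
  field
    nonempty : ∀ i → Satisfiable (A i)
    covers   : ∀ x → ∃[ i ] x ∈ A i
    disjoint : ∀ {i j x} → x ∈ A i → x ∈ A j → i ≡ j

PartitionRegular : Family → Set₁
PartitionRegular F =
  ∀ {m} (A : Fin m → Subset) → IsPartition A → ∃[ i ] A i ∈ F

------------------------------------------------------------------------
-- Polynomials in n variables over ℤ

-- The finitely supported coefficient function of an element of
-- ℤ[x₁,…,xₙ], listed as pairs (exponent vector , nonzero coefficient).

record Polynomial (n : ℕ) : Set where
  field
    terms    : List (Vec ℕ n × ℤ)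
    distinct : Unique (List.map proj₁ terms)
    nonzero  : ListAll.All (λ t → proj₂ t ≢ 0ℤ) terms

open Polynomial public

monomial : Vec ℕ n → Vec ℤ n → ℤ
monomial e x = Vec.foldr′ ℤ._*_ 1ℤ (Vec.zipWith ℤ._^_ x e)

evaluate : Polynomial n → Vec ℤ n → ℤ
evaluate P x =
  List.foldr (λ t s → proj₂ t ℤ.* monomial (proj₁ t) x ℤ.+ s) 0ℤ (terms P)

-- The zero polynomial is homogeneous (of every degree).

IsHomogeneous : Polynomial n → Set
IsHomogeneous P =
  ∃[ d ] ListAll.All (λ t → Vec.sum (proj₁ t) ≡ d) (terms P)

R : Polynomial n → Family
R {n} P A =
  Σ[ a ∈ Vec ℕ n ] VecAll.All (_∈ A) a × evaluate P (Vec.map +_ a) ≡ 0ℤ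

------------------------------------------------------------------------
-- Ultrafilters on ℕ

-- Classically `inhabited` says that ∅ is not a member, and `prime` says
-- that A or its complement is a member.  In the forms used here the
-- axioms hold for principal ultrafilters without excluded middle.

record βℕ : Set₁ where
  field
    members   : Family
    whole     : U ∈ members
    upward    : ∀ {A B} → A ⊆ B → A ∈ members → B ∈ members
    meet      : ∀ {A B} → A ∈ members → B ∈ members → A ∩ B ∈ members
    inhabited : ∀ {A} → A ∈ members → Satisfiable A
    prime     : ∀ {A B} → A ∪ B ∈ members → A ∈ members ⊎ B ∈ members

open βℕ public

-- Equality of ultrafilters: having the same members.

infix 4 _≈_

_≈_ : βℕ → βℕ → Set₁
𝒰 ≈ 𝒱 = members 𝒰 ≐ members 𝒱

infixl 7 _⊙_

_⊙_ : βℕ → βℕ → βℕ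
𝒰 ⊙ 𝒱 = record
  { members   = λ A → (λ s → (λ r → A (s * r)) ∈ members 𝒱) ∈ members 𝒰
  ; whole     = upward 𝒰 (λ _ → whole 𝒱) (whole 𝒰)
  ; upward    = λ A⊆B → upward 𝒰 (upward 𝒱 A⊆B)
  ; meet      = λ a b → upward 𝒰 (λ (p , q) → meet 𝒱 p q) (meet 𝒰 a b)
  ; inhabited = λ a → let (s , p) = inhabited 𝒰 a
                          (r , q) = inhabited 𝒱 p
                      in s * r , q
  ; prime     = λ a → prime 𝒰 (upward 𝒰 (prime 𝒱) a)
  }

principal : ℕ → βℕ
principal k = record
  { members   = λ A → k ∈ A
  ; whole     = _
  ; upward    = λ A⊆B → A⊆B
  ; meet      = _,_
  ; inhabited = k ,_
  ; prime     = λ p → p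
  }

-- The sets ⟦ A ⟧ are the standard base of the Stone topology.

⟦_⟧ : Subset → Pred βℕ 0ℓ
⟦ A ⟧ 𝒰 = A ∈ members 𝒰

closure : Pred βℕ ℓ → Pred βℕ (suc 0ℓ ⊔ ℓ)
closure X 𝒰 = ∀ A → 𝒰 ∈ ⟦ A ⟧ → X ≬ ⟦ A ⟧

IsClosed : Pred βℕ ℓ → Set (suc 0ℓ ⊔ ℓ)
IsClosed X = closure X ⊆ X

-- `resp` makes a predicate on the setoid (βℕ , ≈) a subset of it.

record IsBilateralIdeal (X : Pred βℕ ℓ) : Set (suc 0ℓ ⊔ ℓ) where
  field
    nonempty : Satisfiable X
    resp     : ∀ {𝒰 𝒱} → 𝒰 ≈ 𝒱 → 𝒰 ∈ X → 𝒱 ∈ X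
    left     : ∀ 𝒰 {𝒱} → 𝒱 ∈ X → 𝒰 ⊙ 𝒱 ∈ X
    right    : ∀ {𝒰} 𝒱 → 𝒰 ∈ X → 𝒰 ⊙ 𝒱 ∈ X

-- The minimal bilateral ideal, as the intersection of all bilateral
-- ideals.  Quantifying over predicates in Set₁ suffices classically;
-- that level contains the ideals generated by one ultrafilter.

K : Pred βℕ (suc (suc 0ℓ))
K 𝒰 = ∀ (X : Pred βℕ (suc 0ℓ)) → IsBilateralIdeal X → 𝒰 ∈ X

-- The intersection is itself an ideal, hence the least one.  It is
-- nonempty because 0 ∈ ℕ is absorbing for multiplication.

K-isBilateralIdeal : IsBilateralIdeal K
K-isBilateralIdeal = record
  { nonempty = principal 0 , λ X isIdeal →
      let open IsBilateralIdeal isIdeal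
          (𝒰 , 𝒰∈X) = nonempty
      in resp {principal 0 ⊙ 𝒰} {principal 0}
           ( (λ p → proj₂ (inhabited 𝒰 p))
           , (λ p → upward 𝒰 (λ _ → p) (whole 𝒰)))
           (left (principal 0) 𝒰∈X)
  ; resp  = λ e k X i → IsBilateralIdeal.resp i e (k X i)
  ; left  = λ 𝒰 k X i → IsBilateralIdeal.left i 𝒰 (k X i)
  ; right = λ 𝒱 k X i → IsBilateralIdeal.right i 𝒱 (k X i)
  }

I : Polynomial n → Pred βℕ (suc 0ℓ)
I P 𝒰 = ∀ A → A ∈ members 𝒰 → A ∈ R P

{-# OPTIONS --safe #-}

-- Homogeneity gives P(s a) = s^d P(a), so solutions of P = 0 can be
-- rescaled.  Applied to P-solutions in {r | s r ∈ A} this makes I P a left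
-- ideal; as only finitely many entries occur, an ultrafilter supplies one
-- common factor for all of them, which makes I P a right ideal.  Scaling
-- any solution by 0 puts the principal ultrafilter at 0 in I P.  Hence
-- K ⊆ I P, and the closure of K follows since I P is closed.  Conversely
-- 0 is absorbing, so the principal ultrafilter at 0 lies in K, and (ii)
-- applies to the cell of a partition containing 0.

module Submission where

open import Defs
open import Algebra.Properties.CommutativeSemigroup using (interchange; x∙yz≈y∙xz)
open import Data.Fin.Base using (zero)
open import Data.Integer.Base as ℤ using (ℤ; +_; 0ℤ)
import Data.Integer.Properties as ℤ
open import Data.List.Base as List using (List; []; _∷_)
open import Data.List.Relation.Unary.All as ListAll using ([]; _∷_)
open import Data.Nat.Base using (ℕ; zero; suc; _*_)
open import Data.Nat.Properties using (*-comm)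
open import Data.Product.Base using (_×_; _,_; proj₁; proj₂)
open import Data.Vec.Base as Vec using (Vec; []; _∷_)
open import Data.Vec.Properties using (map-∘; map-cong)
open import Data.Vec.Relation.Unary.All as VecAll using ([]; _∷_)
open import Data.Vec.Relation.Unary.All.Properties using (gmap)
open import Function.Base using (_∘_)
open import Function.Bundles using (_⇔_; mk⇔)
open import Level using (Level)
open import Relation.Binary.PropositionalEquality
  using (_≡_; refl; sym; cong; cong₂; subst; module ≡-Reasoning)
open import Relation.Unary using (Pred; _∈_; _⊆_; U)

private
  variable
    ℓ : Level
    n : ℕ
    A : Subset

open ≡-Reasoning

^-distribʳ-* : ∀ i j m → (i ℤ.* j) ℤ.^ m ≡ i ℤ.^ m ℤ.* j ℤ.^ m
^-distribʳ-* i j zero    = refl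
^-distribʳ-* i j (suc m) = begin
  i ℤ.* j ℤ.* (i ℤ.* j) ℤ.^ m
    ≡⟨ cong (i ℤ.* j ℤ.*_) (^-distribʳ-* i j m) ⟩
  i ℤ.* j ℤ.* (i ℤ.^ m ℤ.* j ℤ.^ m)
    ≡⟨ interchange ℤ.*-commutativeSemigroup i j (i ℤ.^ m) (j ℤ.^ m) ⟩
  i ℤ.^ suc m ℤ.* j ℤ.^ suc m ∎

-- Each variable contributes its own power of `c`, and the exponents add up to the degree of the
-- monomial.
monomial-scale : ∀ c (e : Vec ℕ n) x →
  monomial e (Vec.map (c ℤ.*_) x) ≡ c ℤ.^ Vec.sum e ℤ.* monomial e x
monomial-scale c []      []      = refl
monomial-scale c (k ∷ e) (i ∷ x) = begin
  (c ℤ.* i) ℤ.^ k ℤ.* monomial e (Vec.map (c ℤ.*_) x)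
    ≡⟨ cong₂ ℤ._*_ (^-distribʳ-* c i k) (monomial-scale c e x) ⟩
  c ℤ.^ k ℤ.* i ℤ.^ k ℤ.* (c ℤ.^ Vec.sum e ℤ.* monomial e x)
    ≡⟨ interchange ℤ.*-commutativeSemigroup
         (c ℤ.^ k) (i ℤ.^ k) (c ℤ.^ Vec.sum e) (monomial e x) ⟩
  c ℤ.^ k ℤ.* c ℤ.^ Vec.sum e ℤ.* monomial (k ∷ e) (i ∷ x)
    ≡⟨ cong (ℤ._* monomial (k ∷ e) (i ∷ x)) (ℤ.^-distribˡ-+-* c k (Vec.sum e)) ⟨
  c ℤ.^ Vec.sum (k ∷ e) ℤ.* monomial (k ∷ e) (i ∷ x) ∎

evaluate-scale : (P : Polynomial n) (hom : IsHomogeneous P) → ∀ c x →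
  evaluate P (Vec.map (c ℤ.*_) x) ≡ c ℤ.^ proj₁ hom ℤ.* evaluate P x
evaluate-scale {n} P (d , degrees) c x = go (terms P) degrees
  where
  -- The fold of `evaluate` on an arbitrary list of terms, so that induction on the list is
  -- possible.
  value : Vec ℤ n → List (Vec ℕ n × ℤ) → ℤ
  value y = List.foldr (λ t s → proj₂ t ℤ.* monomial (proj₁ t) y ℤ.+ s) 0ℤ

  go : ∀ ts → ListAll.All (λ t → Vec.sum (proj₁ t) ≡ d) ts →
    value (Vec.map (c ℤ.*_) x) ts ≡ c ℤ.^ d ℤ.* value x ts
  go []             []            = sym (ℤ.*-zeroʳ (c ℤ.^ d))
  -- Matching `refl` identifies `d` with the degree of this term, so the same power of `c` comes out
  -- of head and tail.
  go ((e , q) ∷ ts) (refl ∷ rest) = begin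
    q ℤ.* monomial e (Vec.map (c ℤ.*_) x) ℤ.+ value (Vec.map (c ℤ.*_) x) ts
      ≡⟨ cong₂ (λ m s → q ℤ.* m ℤ.+ s) (monomial-scale c e x) (go ts rest) ⟩
    q ℤ.* (c ℤ.^ d ℤ.* monomial e x) ℤ.+ c ℤ.^ d ℤ.* value x ts
      ≡⟨ cong (ℤ._+ c ℤ.^ d ℤ.* value x ts)
           (x∙yz≈y∙xz ℤ.*-commutativeSemigroup q (c ℤ.^ d) (monomial e x)) ⟩
    c ℤ.^ d ℤ.* (q ℤ.* monomial e x) ℤ.+ c ℤ.^ d ℤ.* value x ts
      ≡⟨ ℤ.*-distribˡ-+ (c ℤ.^ d) (q ℤ.* monomial e x) (value x ts) ⟨
    c ℤ.^ d ℤ.* value x ((e , q) ∷ ts) ∎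

map-pos-* : ∀ s (a : Vec ℕ n) →
  Vec.map +_ (Vec.map (s *_) a) ≡ Vec.map (+ s ℤ.*_) (Vec.map +_ a)
map-pos-* s a = begin
  Vec.map +_ (Vec.map (s *_) a)           ≡⟨ map-∘ +_ (s *_) a ⟨
  Vec.map (λ k → + (s * k)) a             ≡⟨ map-cong (ℤ.pos-* s) a ⟩
  Vec.map (λ k → + s ℤ.* + k) a           ≡⟨ map-∘ (+ s ℤ.*_) +_ a ⟩
  Vec.map (+ s ℤ.*_) (Vec.map +_ a)       ∎

R-scale : (P : Polynomial n) → IsHomogeneous P → ∀ s →
  (λ r → A (s * r)) ∈ R P → A ∈ R P
R-scale P hom s (a , sa∈A , Pa≡0) = Vec.map (s *_) a , gmap (λ p → p) sa∈A , (begin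
  evaluate P (Vec.map +_ (Vec.map (s *_) a))
    ≡⟨ cong (evaluate P) (map-pos-* s a) ⟩
  evaluate P (Vec.map (+ s ℤ.*_) (Vec.map +_ a))
    ≡⟨ evaluate-scale P hom (+ s) (Vec.map +_ a) ⟩
  (+ s) ℤ.^ proj₁ hom ℤ.* evaluate P (Vec.map +_ a)
    ≡⟨ cong ((+ s) ℤ.^ proj₁ hom ℤ.*_) Pa≡0 ⟩
  (+ s) ℤ.^ proj₁ hom ℤ.* 0ℤ
    ≡⟨ ℤ.*-zeroʳ ((+ s) ℤ.^ proj₁ hom) ⟩
  0ℤ ∎)

R-upward : (P : Polynomial n) {B : Subset} → A ⊆ B → A ∈ R P → B ∈ R P
R-upward P A⊆B (a , a∈A , Pa≡0) = a , VecAll.map A⊆B a∈A , Pa≡0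

-- A vector has finitely many entries, so closure under binary `meet` suffices, starting from
-- `whole`.
meet-All : ∀ 𝒱 {B : ℕ → Subset} {a : Vec ℕ n} →
  VecAll.All (λ s → B s ∈ members 𝒱) a →
  (λ r → VecAll.All (λ s → B s r) a) ∈ members 𝒱
meet-All 𝒱 []       = upward 𝒱 (λ _ → []) (whole 𝒱)
meet-All 𝒱 (p ∷ ps) = upward 𝒱 (λ (q , qs) → q ∷ qs) (meet 𝒱 p (meet-All 𝒱 ps))

-- A member of `𝒰` defines a basic neighbourhood of `𝒰`, so it is also a member of some ultrafilter
-- in `X`.
closure⊆ : (F : Family) {X : Pred βℕ ℓ} →
  (∀ 𝒰 → 𝒰 ∈ X → members 𝒰 ⊆ F) → ∀ 𝒰 → 𝒰 ∈ closure X → members 𝒰 ⊆ F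
closure⊆ F X⊆F 𝒰 𝒰∈X̄ {A} A∈𝒰 = let (𝒱 , 𝒱∈X , A∈𝒱) = 𝒰∈X̄ A A∈𝒰 in X⊆F 𝒱 𝒱∈X A∈𝒱

I-isClosed : (P : Polynomial n) → IsClosed (I P)
I-isClosed P {𝒰} 𝒰∈Ī A = closure⊆ (R P) (λ _ 𝒱∈I {B} → 𝒱∈I B) 𝒰 𝒰∈Ī

-- The partition into a single cell already yields a solution in ℕ, possibly a trivial one.
U∈R : (P : Polynomial n) → PartitionRegular (R P) → U ∈ R P
U∈R P regular = proj₂ (regular {1} (λ _ → U) record
  { nonempty = λ _ → 0 , _
  ; covers   = λ _ → zero , _
  ; disjoint = λ { {zero} {zero} _ _ → refl }
  })

I-isBilateralIdeal : (P : Polynomial n) → IsHomogeneous P → U ∈ R P →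
  IsBilateralIdeal (I P)
I-isBilateralIdeal P hom solvable = record
  -- As `0 * r` reduces to `0`, the set of `r` with `0 * r` in `A` is all of ℕ.
  { nonempty = principal 0 , λ A 0∈A → R-scale P hom 0 (R-upward P (λ _ → 0∈A) solvable)
  ; resp     = λ (_ , 𝒱⊆𝒰) 𝒰∈I A A∈𝒱 → 𝒰∈I A (𝒱⊆𝒰 A∈𝒱)
  ; left     = λ 𝒰 𝒱∈I A A∈𝒰𝒱 →
      let (s , A/s∈𝒱) = inhabited 𝒰 A∈𝒰𝒱
      in R-scale P hom s (𝒱∈I _ A/s∈𝒱)
  ; right    = λ 𝒱 𝒰∈I A A∈𝒰𝒱 →
      let (a , A/a∈𝒱 , Pa≡0) = 𝒰∈I _ A∈𝒰𝒱
          -- One `r` that multiplies every entry of the solution `a` into `A`.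
          (r , ar∈A) = inhabited 𝒱 (meet-All 𝒱 {λ s r → A (s * r)} A/a∈𝒱)
      in R-scale P hom r (a , VecAll.map (λ {s} → subst A (*-comm s r)) ar∈A , Pa≡0)
  }

principal-0∈K : principal 0 ∈ K
principal-0∈K = proj₂ (IsBilateralIdeal.nonempty K-isBilateralIdeal)

proposition6p12 : ∀ (n : ℕ) (P : Polynomial n) → IsHomogeneous P →
    (PartitionRegular (R P) ⇔ (∀ 𝒰 → 𝒰 ∈ closure K → members 𝒰 ⊆ R P))
    × (PartitionRegular (R P) → IsClosed (I P) × IsBilateralIdeal (I P))
proposition6p12 n P hom = mk⇔ to from , λ regular → (λ {𝒰} → I-isClosed P {𝒰}) , ideal regular
  where
  ideal : PartitionRegular (R P) → IsBilateralIdeal (I P)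
  ideal = I-isBilateralIdeal P hom ∘ U∈R P

  to : PartitionRegular (R P) → ∀ 𝒰 → 𝒰 ∈ closure K → members 𝒰 ⊆ R P
  -- `I P` lives at the level over which `K` quantifies, so it is one of the ideals intersected.
  to regular = closure⊆ (R P) (λ _ 𝒱∈K {A} → 𝒱∈K (I P) (ideal regular) A)

  from : (∀ 𝒰 → 𝒰 ∈ closure K → members 𝒰 ⊆ R P) → PartitionRegular (R P)
  from K̄⊆R A partition =
    let (i , 0∈Aᵢ) = IsPartition.covers partition 0
    -- `principal 0` itself witnesses that each of its basic neighbourhoods meets `K`.
    in i , K̄⊆R (principal 0) (λ _ 0∈B → principal 0 , principal-0∈K , 0∈B) 0∈Aᵢ
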